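{- For each natural number $n$ consider the following game $G_n$ between Alice and Bob. Alice constructs a partial function $A$ from $\{0,1\}^n$ to $\{0,1\}^n$; Bob constructs a finite list $B_1,\ldots,B_k$ of total functions $\{0,1\}^n\to\{0,1\}^n$. The players alternate; at each move Alice may add several strings to the domain of $A$ and choose values of $A$ on them (existing values cannot be changed), and Bob may append some total functions to his list, provided the total length of the list always remains less than $2^n$; either player may also leave their data unchanged. Alice wins if in the limit there is an $n$-bit string $y$ such that $A(y)$ is defined and $A(y)\ne B_i(y)$ for all functions $B_i$ in Bob's final list. Then Alice has a winning strategy in $G_n$ that is computable uniformly in $n$. -}

module Defs where

open import Data.Nat using (ℕ; zero; suc; _<_; _^_)
open import Data.Bool using (Bool)
open import Data.Vec using (Vec)
open import Data.List using (List; []; _∷_; concat; length)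
open import Data.List.Membership.Propositional using (_∈_)
open import Data.Maybe using (Maybe; just; nothing)
open import Data.Product using (_×_; _,_; Σ; proj₁; proj₂)
open import Relation.Binary.PropositionalEquality using (_≡_; _≢_)
open import Relation.Nullary using (¬_)

Str : ℕ → Set
Str n = Vec Bool n

PFun : ℕ → Set
PFun n = Str n → Maybe (Str n)

TFun : ℕ → Set
TFun n = Str n → Str n

-- Alice's move: a partial function of *additions*; it only takes effect on
-- strings not yet in the domain of A (existing values cannot change).
AMove : ℕ → Set
AMove n = PFun n

BMove : ℕ → Set
BMove n = List (TFun n)

-- Alice's (deterministic) strategy: from the history of Bob's moves so far
-- (most recent first), choose her next move.
AliceStrategy : ℕ → Set
AliceStrategy n = List (BMove n) → AMove n

-- Bob's (arbitrary, adaptive) strategy: from the history of Alice's moves so far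
-- (most recent first, including her move in the current round), choose his move.
BobStrategy : ℕ → Set
BobStrategy n = List (AMove n) → BMove n

extend : ∀ {n} → PFun n → AMove n → PFun n
extend old new y with old y
... | just v  = just v
... | nothing = new y

aliceState : ∀ {n} → List (AMove n) → PFun n
aliceState []       = λ _ → nothing
aliceState (a ∷ as) = extend (aliceState as) a

bobState : ∀ {n} → List (BMove n) → List (TFun n)
bobState bs = concat bs

-- histories of the play before round t; in each round Alice moves, then Bob
history : ∀ {n} → AliceStrategy n → BobStrategy n → ℕ → List (AMove n) × List (BMove n)
history σ τ zero = [] , []
history σ τ (suc t) with history σ τ t
... | as , bs = let a = σ bs in a ∷ as , τ (a ∷ as) ∷ bs

A-at : ∀ {n} → AliceStrategy n → BobStrategy n → ℕ → PFun n
A-at σ τ t = aliceState (proj₁ (history σ τ t))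

B-at : ∀ {n} → AliceStrategy n → BobStrategy n → ℕ → List (TFun n)
B-at σ τ t = bobState (proj₂ (history σ τ t))

BobLegal : ∀ n → AliceStrategy n → BobStrategy n → Set
BobLegal n σ τ = ∀ t → length (B-at σ τ t) < 2 ^ n

GoodString : ∀ n → AliceStrategy n → BobStrategy n → Str n → Set
GoodString n σ τ y =
  Σ ℕ λ t → Σ (Str n) λ v → (A-at σ τ t y ≡ just v) ×
    (∀ t' (B : TFun n) → B ∈ B-at σ τ t' → B y ≢ v)

-- Alice wins: there is such a string y (classical existence, read as ¬¬∃)
AliceWins : ∀ n → AliceStrategy n → BobStrategy n → Set
AliceWins n σ τ = ¬ (∀ (y : Str n) → ¬ GoodString n σ τ y)

Winning : ∀ n → AliceStrategy n → Set
Winning n σ = (τ : BobStrategy n) → BobLegal n σ τ → AliceWins n σ τ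

-- Alice numbers the n-bit strings 0, 1, …, 2^n - 1.  Whenever Bob's list
-- currently has k functions, she defines A on the k-th string y, choosing a
-- value that differs from B(y) for all the k < 2^n functions B in the list;
-- such a value exists by pigeonhole.  Bob's list only grows and its length
-- stays below 2^n, so (classically, hence under a double negation) the length
-- reaches a maximum k at some round s.  The k-th string y then gets its value
-- at the single round where the list had length k, and at that round the list
-- already contained every function Bob ever plays; so A(y) differs from all
-- of them and y witnesses Alice's win.

module Submission where

open import Defs
open import Data.Nat using (ℕ)
open import Data.Product using (Σ)

open import Data.Nat using (zero; suc; _+_; _∸_; _^_; _≤_; _<_; _≤′_; ≤′-refl; ≤′-step; _<?_; s≤s)
open import Data.Nat.Properties
open import Data.Bool using (Bool; true; false) renaming (_≟_ to _≟ᵇ_)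
open import Data.Vec using ([]; _∷_)
open import Data.Vec.Properties using (≡-dec; ∷-injective)
open import Data.List using (List; []; _∷_; _++_; map; length)
open import Data.List.Properties using (length-map; length-++; ++-assoc)
open import Data.List.Membership.Propositional using (_∈_; _∉_)
open import Data.List.Membership.Propositional.Properties using (∈-map⁺; ∈-++⁺ʳ)
open import Data.List.Relation.Binary.Subset.Propositional using (_⊆_)
open import Data.List.Relation.Unary.Any using (here; there)
open import Data.Maybe using (just; nothing)
open import Data.Product using (_×_; _,_; proj₁; proj₂)
open import Data.Sum using (_⊎_; inj₁; inj₂)
open import Data.Empty using (⊥; ⊥-elim)
open import Relation.Nullary using (¬_; yes; no)
open import Relation.Binary.Definitions using (DecidableEquality)
open import Relation.Binary.PropositionalEquality
open ≡-Reasoning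

_≟ₛ_ : ∀ {n} → DecidableEquality (Str n)
_≟ₛ_ = ≡-dec _≟ᵇ_

2^[1+m]≡2^m+2^m : ∀ m → 2 ^ suc m ≡ 2 ^ m + 2 ^ m
2^[1+m]≡2^m+2^m m = cong (2 ^ m +_) (+-identityʳ (2 ^ m))

other-half-small : ∀ {a b N} → a + b < N + N → ¬ a < N → b < N
other-half-small {a} {b} {N} a+b<N+N a≮N =
  +-cancelˡ-< N b N (≤-<-trans (+-monoˡ-≤ b (≮⇒≥ a≮N)) a+b<N+N)

-- Pigeonhole: a list of fewer than 2^m strings of length m misses a string.
-- We split the list by first bit; withHead b L collects the tails of the
-- strings in L whose first bit is b.
withHead : ∀ {m} → Bool → List (Str (suc m)) → List (Str m)
withHead b [] = []
withHead b ((c ∷ v) ∷ L) with c ≟ᵇ b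
... | yes _ = v ∷ withHead b L
... | no _  = withHead b L

withHead-length : ∀ {m} (L : List (Str (suc m))) →
  length (withHead true L) + length (withHead false L) ≡ length L
withHead-length [] = refl
withHead-length ((true ∷ v) ∷ L) = cong suc (withHead-length L)
withHead-length ((false ∷ v) ∷ L) =
  trans (+-suc (length (withHead true L)) _) (cong suc (withHead-length L))

withHead-∈ : ∀ {m} c (v : Str m) L → (c ∷ v) ∈ L → v ∈ withHead c L
withHead-∈ c v ((d ∷ w) ∷ L) (here eq) with d ≟ᵇ c
... | yes _  = here (proj₂ (∷-injective eq))
... | no d≢c = ⊥-elim (d≢c (sym (proj₁ (∷-injective eq))))
withHead-∈ c v ((d ∷ w) ∷ L) (there v∈L) with d ≟ᵇ c
... | yes _ = there (withHead-∈ c v L v∈L)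
... | no _  = withHead-∈ c v L v∈L

-- Choose a first bit with which fewer than 2^m strings of L start (one of
-- the halves is short), and recurse into those strings.
avoid : ∀ m → List (Str m) → Str m
avoid zero _ = []
avoid (suc m) L with length (withHead true L) <? 2 ^ m
... | yes _ = true ∷ avoid m (withHead true L)
... | no _  = false ∷ avoid m (withHead false L)

avoid-∉ : ∀ m (L : List (Str m)) → length L < 2 ^ m → avoid m L ∉ L
avoid-∉ zero [] _ ()
avoid-∉ zero (_ ∷ _) (s≤s ())
avoid-∉ (suc m) L short a∈L with length (withHead true L) <? 2 ^ m
... | yes trueShort = avoid-∉ m _ trueShort (withHead-∈ true _ L a∈L)
... | no trueLong   = avoid-∉ m _ falseShort (withHead-∈ false _ L a∈L)
  where
  falseShort : length (withHead false L) < 2 ^ m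
  falseShort = other-half-small
    (subst₂ _<_ (sym (withHead-length L)) (2^[1+m]≡2^m+2^m m) short) trueLong

-- The enumeration of bit strings: toStr m k is the binary numeral of k < 2^m
-- (most significant bit first), and fromStr reads a numeral back.

toStr : ∀ m → ℕ → Str m
toStr zero _ = []
toStr (suc m) k with k <? 2 ^ m
... | yes _ = false ∷ toStr m k
... | no _  = true ∷ toStr m (k ∸ 2 ^ m)

fromStr : ∀ {m} → Str m → ℕ
fromStr [] = 0
fromStr {suc m} (false ∷ v) = fromStr v
fromStr {suc m} (true ∷ v)  = 2 ^ m + fromStr v

fromStr-toStr : ∀ m k → k < 2 ^ m → fromStr (toStr m k) ≡ k
fromStr-toStr zero zero _ = refl
fromStr-toStr zero (suc _) (s≤s ())
fromStr-toStr (suc m) k k<2^[1+m] with k <? 2 ^ m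
... | yes k<2^m = fromStr-toStr m k k<2^m
... | no k≮2^m  = begin
  2 ^ m + fromStr (toStr m (k ∸ 2 ^ m))  ≡⟨ cong (2 ^ m +_) (fromStr-toStr m _ rest<2^m) ⟩
  2 ^ m + (k ∸ 2 ^ m)                    ≡⟨ m+[n∸m]≡n (≮⇒≥ k≮2^m) ⟩
  k                                      ∎
  where
  rest<2^m : k ∸ 2 ^ m < 2 ^ m
  rest<2^m = m<n+o⇒m∸n<o k (2 ^ m) {{m^n≢0 2 m}}
    (subst (k <_) (2^[1+m]≡2^m+2^m m) k<2^[1+m])

toStr-injective : ∀ m {k k'} → k < 2 ^ m → k' < 2 ^ m → toStr m k ≡ toStr m k' → k ≡ k'
toStr-injective m {k} {k'} k<2^m k'<2^m eq = begin
  k                     ≡⟨ sym (fromStr-toStr m k k<2^m) ⟩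
  fromStr (toStr m k)   ≡⟨ cong fromStr eq ⟩
  fromStr (toStr m k')  ≡⟨ fromStr-toStr m k' k'<2^m ⟩
  k'                    ∎

bounded⇒¬¬max : (f : ℕ → ℕ) (N : ℕ) → (∀ t → f t < N) →
  ¬ ¬ (Σ ℕ λ s → ∀ t → f t ≤ f s)
bounded⇒¬¬max f N bounded noMax = climb N 0 (m≤n+m N (f 0))
  where
  -- Without a maximum, every value can be exceeded, so after d more
  -- increases the sequence would reach N.
  climb : ∀ d t → N ≤ f t + d → ⊥
  climb zero t N≤ft = <⇒≱ (bounded t) (subst (N ≤_) (+-identityʳ (f t)) N≤ft)
  climb (suc d) t N≤ft+1+d = noMax (t , λ t' → ≮⇒≥ λ ft<ft' →
    climb d t' (≤-trans (≤-trans N≤ft+1+d (≤-reflexive (+-suc (f t) d)))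
                        (+-monoˡ-≤ d ft<ft')))

Grows : {A : Set} → (ℕ → List A) → Set
Grows {A} L = ∀ t → Σ (List A) λ p → L (suc t) ≡ p ++ L t

grows-≤′ : ∀ {A : Set} {L : ℕ → List A} → Grows L →
  ∀ {t t'} → t ≤′ t' → Σ (List A) λ p → L t' ≡ p ++ L t
grows-≤′ grows ≤′-refl = [] , refl
grows-≤′ {L = L} grows {t} (≤′-step {t'} t≤′t') with grows-≤′ grows t≤′t' | grows t'
... | p , e | q , e' = q ++ p , (begin
  L (suc t')      ≡⟨ e' ⟩
  q ++ L t'       ≡⟨ cong (q ++_) e ⟩
  q ++ p ++ L t   ≡⟨ ++-assoc q p (L t) ⟨
  (q ++ p) ++ L t ∎)

no-longer⇒empty-prefix : ∀ {A : Set} (q xs : List A) → length (q ++ xs) ≤ length xs → q ≡ []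
no-longer⇒empty-prefix [] xs _ = refl
no-longer⇒empty-prefix (_ ∷ q) xs le =
  ⊥-elim (m+n≮n (length q) (length xs) (subst (λ l → suc l ≤ length xs) (length-++ q) le))

longest-contains-all : ∀ {A : Set} {L : ℕ → List A} → Grows L → ∀ {s} →
  (∀ t → length (L t) ≤ length (L s)) → ∀ t → L t ⊆ L s
longest-contains-all grows {s} longest t x∈Lt with ≤-total t s
... | inj₁ t≤s with grows-≤′ grows (≤⇒≤′ t≤s)
...   | q , Ls≡q++Lt = subst (_ ∈_) (sym Ls≡q++Lt) (∈-++⁺ʳ q x∈Lt)
longest-contains-all {L = L} grows {s} longest t x∈Lt | inj₂ s≤t
  with grows-≤′ grows (≤⇒≤′ s≤t)
... | q , Lt≡q++Ls with no-longer⇒empty-prefix q (L s) (subst (λ l → length l ≤ _) Lt≡q++Ls (longest t))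
...   | refl = subst (_ ∈_) Lt≡q++Ls x∈Lt

extend-cases : ∀ {n} (old new : PFun n) y v → extend old new y ≡ just v →
  (old y ≡ just v) ⊎ (new y ≡ just v)
extend-cases old new y v eq with old y
... | just _  = inj₁ eq
... | nothing = inj₂ eq

extend-defined : ∀ {n} (old new : PFun n) y w → new y ≡ just w →
  Σ (Str n) λ v → extend old new y ≡ just v
extend-defined old new y w eq with old y
... | just v  = v , refl
... | nothing = w , eq

bobHistory : ∀ {n} → AliceStrategy n → BobStrategy n → ℕ → List (BMove n)
bobHistory σ τ t = proj₂ (history σ τ t)

A-at-origin : ∀ {n} (σ : AliceStrategy n) (τ : BobStrategy n) t y v →
  A-at σ τ t y ≡ just v → Σ ℕ λ t₀ → σ (bobHistory σ τ t₀) y ≡ just v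
A-at-origin σ τ zero y v ()
A-at-origin σ τ (suc t) y v eq with extend-cases (A-at σ τ t) (σ (bobHistory σ τ t)) y v eq
... | inj₁ old = A-at-origin σ τ t y v old
... | inj₂ new = t , new

valuesAt : ∀ {n} → Str n → List (TFun n) → List (Str n)
valuesAt y Bs = map (λ B → B y) Bs

diagonal : ∀ n → AliceStrategy n
diagonal n bs y with toStr n (length (bobState bs)) ≟ₛ y
... | yes _ = just (avoid n (valuesAt y (bobState bs)))
... | no _  = nothing

diagonal-just : ∀ n bs y v → diagonal n bs y ≡ just v →
  (toStr n (length (bobState bs)) ≡ y) × (v ≡ avoid n (valuesAt y (bobState bs)))
diagonal-just n bs y v eq with toStr n (length (bobState bs)) ≟ₛ y
diagonal-just n bs y v refl | yes named = named , refl
diagonal-just n bs y v ()   | no _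

diagonal-defined : ∀ n bs → let y = toStr n (length (bobState bs)) in
  diagonal n bs y ≡ just (avoid n (valuesAt y (bobState bs)))
diagonal-defined n bs with toStr n (length (bobState bs)) ≟ₛ toStr n (length (bobState bs))
... | yes _   = refl
... | no y≢y  = ⊥-elim (y≢y refl)

module Play (n : ℕ) (τ : BobStrategy n) (legal : BobLegal n (diagonal n) τ) where

  σ : AliceStrategy n
  σ = diagonal n

  ℓ : ℕ → ℕ
  ℓ t = length (B-at σ τ t)

  bob-grows : Grows (B-at σ τ)
  bob-grows t = _ , refl

  target : ℕ → Str n
  target s = toStr n (ℓ s)

  good-at-max : ∀ s → (∀ t → ℓ t ≤ ℓ s) → GoodString n σ τ (target s)
  good-at-max s longest
    with extend-defined (A-at σ τ s) (σ (bobHistory σ τ s)) (target s) _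
           (diagonal-defined n (bobHistory σ τ s))
  ... | v , Ay≡v with A-at-origin σ τ (suc s) (target s) v Ay≡v
  ... | t₀ , proposed with diagonal-just n (bobHistory σ τ t₀) (target s) v proposed
  ... | named , v≡avoid = suc s , v , Ay≡v , differs
    where
    y : Str n
    y = target s

    -- y was given its value at round t₀, when Bob's list was already longest
    ℓt₀≡ℓs : ℓ t₀ ≡ ℓ s
    ℓt₀≡ℓs = toStr-injective n (legal t₀) (legal s) named

    longest₀ : ∀ t → ℓ t ≤ ℓ t₀
    longest₀ t = subst (ℓ t ≤_) (sym ℓt₀≡ℓs) (longest t)

    differs : ∀ t (B : TFun n) → B ∈ B-at σ τ t → B y ≢ v
    differs t B B∈ By≡v =
      avoid-∉ n (valuesAt y (B-at σ τ t₀))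
        (subst (_< 2 ^ n) (sym (length-map _ (B-at σ τ t₀))) (legal t₀))
        (subst (_∈ valuesAt y (B-at σ τ t₀)) (trans By≡v v≡avoid)
          (∈-map⁺ (λ B → B y) (longest-contains-all bob-grows {t₀} longest₀ t B∈)))

  win : AliceWins n σ τ
  win noGood = bounded⇒¬¬max ℓ (2 ^ n) legal λ (s , longest) →
    noGood (target s) (good-at-max s longest)

lemma3 : Σ ((n : ℕ) → AliceStrategy n) λ σ → (n : ℕ) → Winning n (σ n)
lemma3 = diagonal , λ n τ legal → Play.win n τ legal
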